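{- Let $s$ be a closed term with $s\succ^k t$ for some abstraction $t$. Then the heap machine satisfies $\sigma_s\succ^{4k+2}([],[g],H)$ for some closure $g$ and heap $H$ with $g\gg_H t$.
   Context: Terms (de Bruijn): $s::=n\mid st\mid\lambda s$; $s$ is closed if all its free de Bruijn indices are... none (i.e. every index $n$ occurring under $d$ binders satisfies $n<d$). Term substitution: $k^k_u=u$, $n^k_u=n$ ($n\ne k$), $(st)^k_u=(s^k_u)(t^k_u)$, $(\lambda s)^k_u=\lambda(s^{k+1}_u)$. Reduction: $(\lambda s)(\lambda t)\succ s^0_{\lambda t}$; $s\succ s'\Rightarrow st\succ s't$; $t\succ t'\Rightarrow(\lambda s)t\succ(\lambda s)t'$. Programs: lists of commands $\mathsf{ret},\mathsf{var}\,n,\mathsf{lam},\mathsf{app}$. Compilation: $\gamma n=[\mathsf{var}\,n]$, $\gamma(st)=\gamma s++\gamma t++[\mathsf{app}]$, $\gamma(\lambda s)=\mathsf{lam}::\gamma s++[\mathsf{ret}]$. $P\gg s$ iff $P=\gamma u$ and $s=\lambda u$. $\varphi P:=\varphi_{0,[]}P$ with $\varphi_{0,Q}(\mathsf{ret}::P)=(Q,P)$, $\varphi_{k+1,Q}(\mathsf{ret}::P)=\varphi_{k,Q++[\mathsf{ret}]}P$, $\varphi_{k,Q}(\mathsf{lam}::P)=\varphi_{k+1,Q++[\mathsf{lam}]}P$, $\varphi_{k,Q}(c::P)=\varphi_{k,Q++[c]}P$ for $c$ a $\mathsf{var}$ or $\mathsf{app}$, undefined otherwise. Addresses are natural numbers;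 a closure is a pair $(P,a)$ of a program and an address; a heap entry is a pair $(g,b)$ of a closure and an address; a heap $H$ is a list of heap entries; $H[a]$ is the $a$-th entry of $H$ for $1\le a\le|H|$ (undefined otherwise, in particular for $a=0$). Lookup: if $H[a]=(g,b)$ then $H[a,0]=g$ and $H[a,n+1]=H[b,n]$; otherwise $H[a,n]$ is undefined. Unfolding $\langle s,a\rangle\triangleright^H_k s'$ is defined inductively: $\langle n,a\rangle\triangleright^H_k n$ if $n<k$; $\langle n,a\rangle\triangleright^H_k s'$ if $n\ge k$, $H[a,n-k]=(P,b)$, $P\gg u$ and $\langle u,b\rangle\triangleright^H_0 s'$; $\langle\lambda s,a\rangle\triangleright^H_k\lambda s'$ if $\langle s,a\rangle\triangleright^H_{k+1}s'$; $\langle st,a\rangle\triangleright^H_k s't'$ if $\langle s,a\rangle\triangleright^H_k s'$ and $\langle t,a\rangle\triangleright^H_k t'$. A closure represents a term, $(P,a)\gg_H s$, iff $P\gg u$ and $\langle u,a\rangle\triangleright^H_0 s$ for some $u$. The heap machine has states $(T,V,H)$ with $T,V$ lists of closures and steps: $((\mathsf{var}\,n::P,a)::T,V,H)\succ((P,a)::T,g::V,H)$ if $H[a,n]=g$; $((\mathsf{lam}::P,a)::T,V,H)\succ((P',a)::T,(Q,a)::V,H)$ if $\varphi P=(Q,P')$; $((\mathsf{app}::P,a)::T,g::(Q,b)::V,H)\succ((Q,|H|+1)::(P,a)::T,V,H++[(g,b)])$; $(([],a)::T,V,H)\succ(T,V,H)$. The initial state is $\sigma_s:=([(\gamma s,0)],[],[])$.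 -}

module Defs where

open import Data.Bool using (if_then_else_)
open import Data.List using (List; []; _∷_; _++_; [_]; _∷ʳ_; length; head; drop)
open import Data.Maybe as Maybe using (Maybe; just; nothing; _>>=_)
open import Data.Nat using (ℕ; zero; suc; _+_; _∸_; _≤_; _<_; _≡ᵇ_)
open import Data.Product using (_×_; _,_; ∃-syntax; proj₁; proj₂)
open import Level using (Level)
open import Relation.Binary using (Rel)
open import Relation.Binary.PropositionalEquality using (_≡_)

-- k-fold iteration of a relation: exactly k steps.
data Power {a ℓ : Level} {A : Set a} (R : Rel A ℓ) : ℕ → A → A → Set (a Level.⊔ ℓ) where
  done : ∀ {x} → Power R zero x x
  step : ∀ {k x y z} → R x y → Power R k y z → Power R (suc k) x z

infixl 9 _·_
infixr 8 ƛ_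

data Term : Set where
  ix  : ℕ → Term
  _·_ : Term → Term → Term
  ƛ_  : Term → Term

data Abstraction : Term → Set where
  abstraction : ∀ {s} → Abstraction (ƛ s)

-- Bound d s: every index n occurring in s under e further binders satisfies
-- n < d + e.
data Bound (d : ℕ) : Term → Set where
  ix  : ∀ {n} → n < d → Bound d (ix n)
  _·_ : ∀ {s t} → Bound d s → Bound d t → Bound d (s · t)
  ƛ_  : ∀ {s} → Bound (suc d) s → Bound d (ƛ s)

Closed : Term → Set
Closed = Bound 0

-- The substituted term u is not shifted under binders, and the remaining
-- indices are not decremented.
subst : Term → ℕ → Term → Term
subst (ix n)  k u = if n ≡ᵇ k then u else ix n
subst (s · t) k u = subst s k u · subst t k u
subst (ƛ s)   k u = ƛ subst s (suc k) u

infix 4 _≻_ _≻[_]_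

data _≻_ : Term → Term → Set where
  β  : ∀ {s t} → (ƛ s) · (ƛ t) ≻ subst s 0 (ƛ t)
  ξˡ : ∀ {s s′ t} → s ≻ s′ → s · t ≻ s′ · t
  ξʳ : ∀ {s t t′} → t ≻ t′ → (ƛ s) · t ≻ (ƛ s) · t′

_≻[_]_ : Term → ℕ → Term → Set
s ≻[ k ] t = Power _≻_ k s t

data Command : Set where
  ret : Command
  var : ℕ → Command
  lam : Command
  app : Command

Program : Set
Program = List Command

γ : Term → Program
γ (ix n)  = [ var n ]
γ (s · t) = γ s ++ γ t ++ [ app ]
γ (ƛ s)   = lam ∷ γ s ++ [ ret ]

infix 4 _≫_

_≫_ : Program → Term → Set
P ≫ s = ∃[ u ] (P ≡ γ u × s ≡ ƛ u)

-- Splits the input at the ret that closes an already opened lam, with k nested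
-- lams still open; Q accumulates the commands read so far.
φ′ : ℕ → Program → Program → Maybe (Program × Program)
φ′ k       Q []          = nothing
φ′ zero    Q (ret ∷ P)   = just (Q , P)
φ′ (suc k) Q (ret ∷ P)   = φ′ k (Q ∷ʳ ret) P
φ′ k       Q (lam ∷ P)   = φ′ (suc k) (Q ∷ʳ lam) P
φ′ k       Q (var n ∷ P) = φ′ k (Q ∷ʳ var n) P
φ′ k       Q (app ∷ P)   = φ′ k (Q ∷ʳ app) P

φ : Program → Maybe (Program × Program)
φ = φ′ 0 []

Address : Set
Address = ℕ

Closure : Set
Closure = Program × Address

HeapEntry : Set
HeapEntry = Closure × Address

Heap : Set
Heap = List HeapEntry

-- Addresses count from 1; address 0 has no entry.
entry : Heap → Address → Maybe HeapEntry
entry H zero    = nothing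
entry H (suc a) = head (drop a H)

lookup : Heap → Address → ℕ → Maybe Closure
lookup H a zero    = Maybe.map proj₁ (entry H a)
lookup H a (suc n) = entry H a >>= λ (_ , b) → lookup H b n

infix 4 ⟨_,_⟩▷[_,_]_

-- ⟨ s , a ⟩▷[ H , k ] s′: the term s, with its indices ≥ k looked up in H
-- from address a, unfolds to s′.
data ⟨_,_⟩▷[_,_]_ : Term → Address → Heap → ℕ → Term → Set where
  bound : ∀ {n a H k} → n < k → ⟨ ix n , a ⟩▷[ H , k ] ix n
  free  : ∀ {n a H k P b u s′} → k ≤ n → lookup H a (n ∸ k) ≡ just (P , b) →
          P ≫ u → ⟨ u , b ⟩▷[ H , 0 ] s′ → ⟨ ix n , a ⟩▷[ H , k ] s′
  ƛ_    : ∀ {s a H k s′} → ⟨ s , a ⟩▷[ H , suc k ] s′ →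
          ⟨ ƛ s , a ⟩▷[ H , k ] ƛ s′
  _·_   : ∀ {s t a H k s′ t′} → ⟨ s , a ⟩▷[ H , k ] s′ →
          ⟨ t , a ⟩▷[ H , k ] t′ → ⟨ s · t , a ⟩▷[ H , k ] s′ · t′

infix 4 _≫[_]_

_≫[_]_ : Closure → Heap → Term → Set
(P , a) ≫[ H ] s = ∃[ u ] (P ≫ u × ⟨ u , a ⟩▷[ H , 0 ] s)

State : Set
State = List Closure × List Closure × Heap

infix 4 _⟶_ _⟶[_]_

data _⟶_ : State → State → Set where
  var-step : ∀ {n P a T V H g} → lookup H a n ≡ just g →
             ((var n ∷ P , a) ∷ T , V , H) ⟶ ((P , a) ∷ T , g ∷ V , H)
  lam-step : ∀ {P a T V H Q P′} → φ P ≡ just (Q , P′) →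
             ((lam ∷ P , a) ∷ T , V , H) ⟶ ((P′ , a) ∷ T , (Q , a) ∷ V , H)
  app-step : ∀ {P a T V H g Q b} →
             ((app ∷ P , a) ∷ T , g ∷ (Q , b) ∷ V , H) ⟶
             ((Q , length H + 1) ∷ (P , a) ∷ T , V , H ++ [ (g , b) ])
  nil-step : ∀ {a T V H} → (([] , a) ∷ T , V , H) ⟶ (T , V , H)

_⟶[_]_ : State → ℕ → State → Set
σ ⟶[ k ] τ = Power _⟶_ k σ τ

initial : Term → State
initial s = [ (γ s , 0) ] , [] , []

{-# OPTIONS --safe #-}
-- A big-step evaluation with step count k is simulated in 4k + 1 machine steps:
-- each β-step pays for its app, for the nil that leaves the callee, and for one
-- step each to push the operator and the operand values; the remaining step
-- pushes the final value. In a call, the substitution s^0_u is not performed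
-- but represented: extending the environment of s by a closure for u makes s
-- unfold to s^0_u. This is sound because everything looked up in a heap unfolds
-- to a closed term, on which substitution is the identity.
module Submission where

open import Defs
open import Data.List using ([]; _∷_; _++_; [_]; _∷ʳ_; length)
open import Data.List.Properties using (++-assoc; ++-identityʳ)
open import Data.Maybe as Maybe using (just; _>>=_)
open import Data.Nat using (ℕ; zero; suc; _+_; _*_; _∸_; _≤_; z≤n; s≤s; s≤s⁻¹)
open import Data.Nat.Properties
  using (≤-refl; ≤-trans; n≤1+n; <⇒≢; ≤∧≢⇒<; n∸n≡0; +-∸-assoc; +-assoc; +-comm; _≟_)
open import Data.Nat.Tactic.RingSolver using (solve-∀)
open import Data.Product using (_×_; _,_; ∃-syntax; proj₁)
open import Relation.Binary using (Rel)
open import Relation.Binary.PropositionalEquality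
  using (_≡_; _≢_; refl; sym; trans; cong; cong₂; module ≡-Reasoning)
open import Relation.Nullary using (yes; no)
open import Relation.Nullary.Decidable using (dec-true; dec-false)

private variable
  s s′ t t′ u v : Term
  i j k m n     : ℕ
  a b           : Address
  H H′ H″       : Heap

infixr 5 _++ᴾ_

_++ᴾ_ : ∀ {a ℓ} {A : Set a} {R : Rel A ℓ} {x y z} →
        Power R m x y → Power R n y z → Power R (m + n) x z
done     ++ᴾ q = q
step r p ++ᴾ q = step r (p ++ᴾ q)

infix 4 _⇓[_]_

data _⇓[_]_ : Term → ℕ → Term → Set where
  ƛ⇓ : ƛ s ⇓[ 0 ] ƛ s
  ·⇓ : s ⇓[ i ] ƛ s′ → t ⇓[ j ] ƛ t′ → subst s′ 0 (ƛ t′) ⇓[ k ] v →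
       s · t ⇓[ suc (i + j + k) ] v

-- A congruence step raises the count of one premise. Under `ξʳ` the operator is a value of count 0,
-- so the `suc` comes to the front by computation.
≻-⇓ : s ≻ t → t ⇓[ k ] v → s ⇓[ suc k ] v
≻-⇓ β      d             = ·⇓ ƛ⇓ ƛ⇓ d
≻-⇓ (ξˡ r) (·⇓ d e f)    = ·⇓ (≻-⇓ r d) e f
≻-⇓ (ξʳ r) (·⇓ ƛ⇓ e f)   = ·⇓ ƛ⇓ (≻-⇓ r e) f

≻*⇒⇓ : s ≻[ k ] t → Abstraction t → s ⇓[ k ] t
≻*⇒⇓ done       abstraction = ƛ⇓
≻*⇒⇓ (step r p) abs         = ≻-⇓ r (≻*⇒⇓ p abs)

-- Not definitional for open k: the case tree of φ′ splits k before the command.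
φ′-lam : ∀ k Q P → φ′ k Q (lam ∷ P) ≡ φ′ (suc k) (Q ∷ʳ lam) P
φ′-lam zero    Q P = refl
φ′-lam (suc k) Q P = refl

φ′-app : ∀ k Q P → φ′ k Q (app ∷ P) ≡ φ′ k (Q ∷ʳ app) P
φ′-app zero    Q P = refl
φ′-app (suc k) Q P = refl

-- Compiled code is balanced: each `lam` meets its own `ret`, so the scan leaves `γ s` at the depth
-- where it entered.
φ′-γ : ∀ s k Q P → φ′ k Q (γ s ++ P) ≡ φ′ k (Q ++ γ s) P
φ′-γ (ix n)  zero    Q P = refl
φ′-γ (ix n)  (suc k) Q P = refl
φ′-γ (s · t) k Q P = begin
  φ′ k Q ((γ s ++ γ t ++ [ app ]) ++ P)     ≡⟨ cong (φ′ k Q) (++-assoc (γ s) _ P) ⟩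
  φ′ k Q (γ s ++ (γ t ++ [ app ]) ++ P)     ≡⟨ φ′-γ s k Q _ ⟩
  φ′ k (Q ++ γ s) ((γ t ++ [ app ]) ++ P)   ≡⟨ cong (φ′ k (Q ++ γ s)) (++-assoc (γ t) _ P) ⟩
  φ′ k (Q ++ γ s) (γ t ++ app ∷ P)          ≡⟨ φ′-γ t k (Q ++ γ s) _ ⟩
  φ′ k ((Q ++ γ s) ++ γ t) (app ∷ P)        ≡⟨ φ′-app k _ P ⟩
  φ′ k (((Q ++ γ s) ++ γ t) ∷ʳ app) P       ≡⟨ cong (λ R → φ′ k R P) (++-assoc (Q ++ γ s) (γ t) _) ⟩
  φ′ k ((Q ++ γ s) ++ γ t ++ [ app ]) P     ≡⟨ cong (λ R → φ′ k R P) (++-assoc Q (γ s) _) ⟩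
  φ′ k (Q ++ γ s ++ γ t ++ [ app ]) P       ∎
  where open ≡-Reasoning
φ′-γ (ƛ s)   k Q P = begin
  φ′ k Q (lam ∷ (γ s ++ [ ret ]) ++ P)            ≡⟨ φ′-lam k Q _ ⟩
  φ′ (suc k) (Q ∷ʳ lam) ((γ s ++ [ ret ]) ++ P)   ≡⟨ cong (φ′ (suc k) (Q ∷ʳ lam)) (++-assoc (γ s) _ P) ⟩
  φ′ (suc k) (Q ∷ʳ lam) (γ s ++ ret ∷ P)          ≡⟨ φ′-γ s (suc k) (Q ∷ʳ lam) _ ⟩
  -- At depth `suc k` the `ret` is consumed by computation, which restores depth `k`.
  φ′ k (((Q ∷ʳ lam) ++ γ s) ∷ʳ ret) P             ≡⟨ cong (λ R → φ′ k R P) (++-assoc (Q ∷ʳ lam) (γ s) _) ⟩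
  φ′ k ((Q ∷ʳ lam) ++ γ s ++ [ ret ]) P           ≡⟨ cong (λ R → φ′ k R P) (++-assoc Q _ _) ⟩
  φ′ k (Q ++ lam ∷ γ s ++ [ ret ]) P              ∎
  where open ≡-Reasoning

φ-γ-ret : ∀ s P → φ ((γ s ++ [ ret ]) ++ P) ≡ just (γ s , P)
φ-γ-ret s P = trans (cong φ (++-assoc (γ s) _ P)) (φ′-γ s 0 [] (ret ∷ P))

infix 4 _⊑_

-- Entrywise, since lookups and unfoldings inspect a heap only through `entry`.
_⊑_ : Heap → Heap → Set
H ⊑ H′ = ∀ a {e} → entry H a ≡ just e → entry H′ a ≡ just e

⊑-refl : H ⊑ H
⊑-refl a eq = eq

⊑-trans : H ⊑ H′ → H′ ⊑ H″ → H ⊑ H″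
⊑-trans p q a eq = q a (p a eq)

⊑-++ : ∀ H H′ → H ⊑ H ++ H′
⊑-++ (_ ∷ H) H′ (suc zero)    eq = eq
⊑-++ (_ ∷ H) H′ (suc (suc a)) eq = ⊑-++ H H′ (suc a) eq
⊑-++ []      H′ (suc zero)    ()
⊑-++ []      H′ (suc (suc a)) ()

entry-last : ∀ H e → entry (H ++ [ e ]) (length H + 1) ≡ just e
entry-last H e rewrite +-comm (length H) 1 = go H
  where
  go : ∀ H → entry (H ++ [ e ]) (suc (length H)) ≡ just e
  go []      = refl
  go (_ ∷ H) = go H

lookup-⊑ : ∀ H n {g} → H ⊑ H′ → lookup H a n ≡ just g → lookup H′ a n ≡ just g
lookup-⊑ {a = a} H zero    ext eq with entry H a in eqₐ
... | just _ rewrite ext a eqₐ = eq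
lookup-⊑ {a = a} H (suc n) ext eq with entry H a in eqₐ
... | just _ rewrite ext a eqₐ = lookup-⊑ H n ext eq

▷-⊑ : H ⊑ H′ → ⟨ s , a ⟩▷[ H , k ] t → ⟨ s , a ⟩▷[ H′ , k ] t
▷-⊑ ext (bound n<k) = bound n<k
▷-⊑ {H} {k = k} ext (free {n} k≤n eq p d) =
  free k≤n (lookup-⊑ H (n ∸ k) ext eq) p (▷-⊑ {H} ext d)
▷-⊑ {H} ext (ƛ d)   = ƛ ▷-⊑ {H} ext d
▷-⊑ {H} ext (d · e) = ▷-⊑ {H} ext d · ▷-⊑ {H} ext e

Bound-mono : i ≤ j → Bound i s → Bound j s
Bound-mono i≤j (ix n<i) = ix (≤-trans n<i i≤j)
Bound-mono i≤j (p · q)  = Bound-mono i≤j p · Bound-mono i≤j q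
Bound-mono i≤j (ƛ p)    = ƛ Bound-mono (s≤s i≤j) p

subst-ix-≢ : n ≢ k → subst (ix n) k u ≡ ix n
subst-ix-≢ {n} {k} n≢k rewrite dec-false (n ≟ k) n≢k = refl

subst-ix-≡ : ∀ k → subst (ix k) k u ≡ u
subst-ix-≡ k rewrite dec-true (k ≟ k) refl = refl

subst-Bound : Bound k s → subst s k u ≡ s
subst-Bound (ix n<k) = subst-ix-≢ (<⇒≢ n<k)
subst-Bound (p · q)  = cong₂ _·_ (subst-Bound p) (subst-Bound q)
subst-Bound (ƛ p)    = cong ƛ_ (subst-Bound p)

-- An index that is not kept is replaced by a term unfolded at level 0, which is closed by
-- induction.
▷-Bound : ⟨ s , a ⟩▷[ H , k ] t → Bound k t
▷-Bound (bound n<k)    = ix n<k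
▷-Bound (free _ _ _ d) = Bound-mono z≤n (▷-Bound d)
▷-Bound (ƛ d)          = ƛ ▷-Bound d
▷-Bound (d · e)        = ▷-Bound d · ▷-Bound e

Bound⇒▷ : Bound k s → ⟨ s , a ⟩▷[ H , k ] s
Bound⇒▷ (ix n<k) = bound n<k
Bound⇒▷ (p · q)  = Bound⇒▷ p · Bound⇒▷ q
Bound⇒▷ (ƛ p)    = ƛ Bound⇒▷ p

-- Lowering the level to `k` frees exactly the index `k`, which the entry at `a` resolves to `g`;
-- larger indices pass through that entry to `b`.
▷-subst : ∀ {g} → entry H a ≡ just (g , b) → g ≫[ H ] u →
          ⟨ s , b ⟩▷[ H , suc k ] t → ⟨ s , a ⟩▷[ H , k ] subst t k u
▷-subst {H} {a} {u = u} {k = k} eq (_ , p , d) (bound {n} n<1+k) with n ≟ k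
... | no n≢k rewrite subst-ix-≢ {u = u} n≢k = bound (≤∧≢⇒< (s≤s⁻¹ n<1+k) n≢k)
... | yes refl rewrite subst-ix-≡ {u} k =
  free ≤-refl (trans (cong (lookup H a) (n∸n≡0 k)) (cong (Maybe.map proj₁) eq)) p d
▷-subst {H} {a} {u = u} {k = k} eq _ (free {suc n} (s≤s k≤n) eq′ p d)
  rewrite subst-Bound {k} {u = u} (Bound-mono z≤n (▷-Bound d)) =
  free (≤-trans k≤n (n≤1+n n)) lookup≡ p d
  where
  lookup≡ : lookup H a (suc n ∸ k) ≡ just _
  -- As `k ≤ n`, the offset is a successor and the lookup follows one link, from `a` to `b`.
  lookup≡ = trans (cong (lookup H a) (+-∸-assoc 1 k≤n))
                  (trans (cong (_>>= λ (_ , b) → lookup H b (n ∸ k)) eq) eq′)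
▷-subst eq g (ƛ d)   = ƛ ▷-subst eq g d
▷-subst eq g (d · e) = ▷-subst eq g d · ▷-subst eq g e

-- The right side follows the run of an application: operator, operand, `app-step`, body,
-- `nil-step`.
step-count : ∀ i j k → 4 * suc (i + j + k) + 1 ≡
             (4 * i + 1) + ((4 * j + 1) + suc ((4 * k + 1) + 1))
step-count = solve-∀

-- The machine runs the code of `u`, which only unfolds to `s`, because substitutions stay delayed
-- in the heap. Arbitrary `P`, `T` and `V` let the induction reach subterms inside surrounding code;
-- `H ⊑ H′` preserves what earlier closures represent.
⇓-simulation : s ⇓[ k ] t → ⟨ u , a ⟩▷[ H , 0 ] s → ∀ P T V → ∃[ g ] ∃[ H′ ]
  (((γ u ++ P , a) ∷ T , V , H) ⟶[ 4 * k + 1 ] ((P , a) ∷ T , g ∷ V , H′) ×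
   H ⊑ H′ × g ≫[ H′ ] t)
⇓-simulation ƛ⇓ (free _ eq (_ , p , refl) (ƛ d)) P T V =
  _ , _ , step (var-step eq) done , ⊑-refl , _ , (_ , p , refl) , ƛ d
-- A looked-up closure holds the body of an abstraction, so it cannot unfold to an application.
⇓-simulation (·⇓ _ _ _) (free _ _ (_ , _ , refl) ()) P T V
⇓-simulation ƛ⇓ (ƛ_ {s = u} d) P T V =
  _ , _ , step (lam-step (φ-γ-ret u P)) done , ⊑-refl , _ , (_ , refl , refl) , ƛ d
⇓-simulation {a = a} {H = H} (·⇓ {i = i} {j = j} {k = k} d e f) (_·_ {s = u₁} {t = u₂} x y) P T V
  with ⇓-simulation d x (γ u₂ ++ app ∷ P) T V
... | (_ , b) , H₁ , run₁ , H⊑H₁ , _ , (w , refl , refl) , ƛ z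
  with ⇓-simulation e (▷-⊑ {H} H⊑H₁ y) (app ∷ P) T ((γ w , b) ∷ V)
... | g₂ , H₂ , run₂ , H₁⊑H₂ , w₂ , p₂ , z₂
  with ⊑-++ H₂ [ (g₂ , b) ]
... | H₂⊑H₃
  -- The appended entry binds the operand value to index 0 of the body `w`, so `w` at the new
  -- address unfolds to the contractum.
  with ⇓-simulation f
         (▷-subst (entry-last H₂ (g₂ , b)) (w₂ , p₂ , ▷-⊑ {H₂} H₂⊑H₃ z₂)
           (▷-⊑ {H₁} (⊑-trans {H₁} H₁⊑H₂ H₂⊑H₃) z))
         [] ((P , a) ∷ T) V
... | g , H′ , run₃ , H₃⊑H′ , value
  rewrite ++-identityʳ (γ w)
        | ++-assoc (γ u₁) (γ u₂ ++ [ app ]) P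
        | ++-assoc (γ u₂) [ app ] P
        | step-count i j k =
  g , H′ , run₁ ++ᴾ run₂ ++ᴾ step app-step (run₃ ++ᴾ step nil-step done) ,
  ⊑-trans {H} H⊑H₁ (⊑-trans {H₁} H₁⊑H₂ (⊑-trans {H₂} H₂⊑H₃ H₃⊑H′)) , value

theorem16 : ∀ (s t : Term) (k : ℕ) → Closed s → s ≻[ k ] t → Abstraction t →
    ∃[ g ] ∃[ H ] (initial s ⟶[ 4 * k + 2 ] ([] , [ g ] , H) × g ≫[ H ] t)
theorem16 s t k closed r abs
  with ⇓-simulation (≻*⇒⇓ r abs) (Bound⇒▷ {a = 0} {H = []} closed) [] [] []
... | g , H , run , _ , value
  -- After `4 * k + 1` steps the value is pushed; one more `nil-step` drops the exhausted program.
  rewrite ++-identityʳ (γ s) | sym (+-assoc (4 * k) 1 1) =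
  g , H , run ++ᴾ step nil-step done , value
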